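{- Let $D$ be a weighted digraph and let $\nu$ be the number of vertices of a longest directed path in $D$. If $\nu$ is odd, then $\mathrm{mac}(D)\ge\left(\frac14+\frac{1}{4\nu}\right)w(D)$; if $\nu$ is even, then $\mathrm{mac}(D)\ge\left(\frac14+\frac{1}{4(\nu-1)}\right)w(D)$.
   Context: A weighted digraph $D=(V,A,w)$ is a digraph without loops or parallel arcs (opposite arcs allowed) with weights $w:A\to\mathbb{R}_{\ge0}$; $w(D)$ is the total arc weight. For a partition $(X,Y)$ of $V$, $w(X,Y)$ is the total weight of arcs from $X$ to $Y$, and $\mathrm{mac}(D)=\max_{(X,Y)}w(X,Y)$ over all partitions. -}

module Defs where

open import Data.Bool.Base using (if_then_else_; true; false)
open import Data.Fin.Base using (Fin)
open import Data.Fin.Subset using (Subset; ∁)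
open import Data.Fin.Subset.Properties using (_∈?_)
open import Data.Integer.Base as ℤ using (ℤ; +_)
import Data.Integer.Properties as ℤ
open import Data.List.Base using (List; length)
open import Data.List.Relation.Unary.Linked using (Linked)
open import Data.List.Relation.Unary.Unique.Propositional using (Unique)
open import Data.Nat.Base as ℕ using (ℕ; zero; suc)
open import Data.Nat.Divisibility using (_∣_; _∤_; _∣0; ∣1⇒≡1)
import Data.Nat.Properties as ℕ
open import Data.Product.Base using (_×_; _,_; proj₁; proj₂; ∃-syntax)
open import Data.Rational.Base as ℚ using (ℚ; 0ℚ; 1ℚ; ½; _/_; 1/_)
import Data.Rational.Properties as ℚ
open import Data.Rational.Solver using (module +-*-Solver)
open import Data.Rational.Unnormalised.Base as ℚᵘ using (*≡*)
open import Data.Sum.Base using (inj₁; inj₂)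
open import Data.Vec.Base using ([]; _∷_)
open import Data.Vec.Functional using (Vector; foldr)
open import Function.Base using (_∘_)
open import Level using (0ℓ)
open import Relation.Binary.Core using (Rel)
open import Relation.Binary.Definitions using (Decidable; Irreflexive)
open import Relation.Binary.PropositionalEquality
  using (_≡_; _≢_; refl; sym; trans; cong; subst)
open import Relation.Nullary using (yes; no; does)
open import Relation.Nullary.Decidable using (_×-dec_)

IsCauchy : (ℕ → ℚ) → Set
IsCauchy x = ∀ ε → 0ℚ ℚ.< ε →
  ∃[ N ] (∀ m n → N ℕ.≤ m → N ℕ.≤ n → ℚ.∣ x m ℚ.- x n ∣ ℚ.≤ ε)

-- A real number is represented by a rational sequence converging to it; the
-- operations below act on the sequences pointwise.

record ℝ : Set where
  constructor mkℝ
  field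
    seq    : ℕ → ℚ
    cauchy : IsCauchy seq

open ℝ public

infix 4 _≤_ _≥_ _≃_

-- This compares the limits of the sequences, so that _≃_ (and not _≡_) is
-- equality of real numbers.

_≤_ : Rel ℝ 0ℓ
x ≤ y = ∀ ε → 0ℚ ℚ.< ε →
  ∃[ N ] (∀ n → N ℕ.≤ n → seq x n ℚ.≤ seq y n ℚ.+ ε)

_≥_ : Rel ℝ 0ℓ
x ≥ y = y ≤ x

_≃_ : Rel ℝ 0ℓ
x ≃ y = x ≤ y × y ≤ x

open +-*-Solver using (solve; _:=_; _:+_; _:*_; _:-_; :-_)

half-pos : ∀ {ε} → 0ℚ ℚ.< ε → 0ℚ ℚ.< ½ ℚ.* ε
half-pos 0<ε = ℚ.*-monoʳ-<-pos ½ 0<ε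

half+half : ∀ ε → ½ ℚ.* ε ℚ.+ ½ ℚ.* ε ≡ ε
half+half ε = trans (sym (ℚ.*-distribʳ-+ ε ½ ½)) (ℚ.*-identityˡ ε)

p≤∣p∣ : ∀ p → p ℚ.≤ ℚ.∣ p ∣
p≤∣p∣ p with ℚ.≤-total 0ℚ p
... | inj₁ 0≤p = ℚ.≤-reflexive (sym (ℚ.0≤p⇒∣p∣≡p 0≤p))
... | inj₂ p≤0 = ℚ.≤-trans p≤0 (ℚ.0≤∣p∣ p)

p-q+q : ∀ p q → p ℚ.- q ℚ.+ q ≡ p
p-q+q = solve 2 (λ p q → p :- q :+ q := p) refl

p-q≤r⇒p≤r+q : ∀ p q {r} → p ℚ.- q ℚ.≤ r → p ℚ.≤ r ℚ.+ q
p-q≤r⇒p≤r+q p q {r} h =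
  subst (ℚ._≤ r ℚ.+ q) (p-q+q p q) (ℚ.+-monoˡ-≤ q h)

p+q-q : ∀ p q → p ℚ.+ q ℚ.- q ≡ p
p+q-q = solve 2 (λ p q → p :+ q :- q := p) refl

p≤r+q⇒p-q≤r : ∀ p q {r} → p ℚ.≤ r ℚ.+ q → p ℚ.- q ℚ.≤ r
p≤r+q⇒p-q≤r p q {r} h =
  subst (p ℚ.- q ℚ.≤_) (p+q-q r q) (ℚ.+-monoˡ-≤ (ℚ.- q) h)

swap-sub : ∀ p q → ℚ.- (p ℚ.- q) ≡ q ℚ.- p
swap-sub = solve 2 (λ p q → :- (p :- q) := q :- p) refl

∣-∣-sym : ∀ p q → ℚ.∣ p ℚ.- q ∣ ≡ ℚ.∣ q ℚ.- p ∣
∣-∣-sym p q =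
  trans (sym (ℚ.∣-p∣≡∣p∣ (p ℚ.- q))) (cong ℚ.∣_∣ (swap-sub p q))

both⇒∣-∣≤ : ∀ p q {ε} → p ℚ.- q ℚ.≤ ε → q ℚ.- p ℚ.≤ ε → ℚ.∣ p ℚ.- q ∣ ℚ.≤ ε
both⇒∣-∣≤ p q {ε} h k with ℚ.∣p∣≡p∨∣p∣≡-p (p ℚ.- q)
... | inj₁ e = subst (ℚ._≤ ε) (sym e) h
... | inj₂ e = subst (ℚ._≤ ε) (sym (trans e (swap-sub p q))) k

⊔-sub-≤ : ∀ p q r s {ε} → ℚ.∣ p ℚ.- r ∣ ℚ.≤ ε → ℚ.∣ q ℚ.- s ∣ ℚ.≤ ε →
          (p ℚ.⊔ q) ℚ.- (r ℚ.⊔ s) ℚ.≤ ε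
⊔-sub-≤ p q r s {ε} h k = p≤r+q⇒p-q≤r (p ℚ.⊔ q) (r ℚ.⊔ s) (ℚ.⊔-lub
  (ℚ.≤-trans (p-q≤r⇒p≤r+q p r (ℚ.≤-trans (p≤∣p∣ _) h))
             (ℚ.+-monoʳ-≤ ε (ℚ.p≤p⊔q r s)))
  (ℚ.≤-trans (p-q≤r⇒p≤r+q q s (ℚ.≤-trans (p≤∣p∣ _) k))
             (ℚ.+-monoʳ-≤ ε (ℚ.p≤q⊔p r s))))

interchange : ∀ p q r s → (p ℚ.+ q) ℚ.- (r ℚ.+ s) ≡ (p ℚ.- r) ℚ.+ (q ℚ.- s)
interchange = solve 4 (λ p q r s → (p :+ q) :- (r :+ s) := (p :- r) :+ (q :- s)) refl

*-sub : ∀ c p q → c ℚ.* p ℚ.- c ℚ.* q ≡ c ℚ.* (p ℚ.- q)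
*-sub = solve 3 (λ c p q → c :* p :- c :* q := c :* (p :- q)) refl

+-cauchy : ∀ x y → IsCauchy x → IsCauchy y → IsCauchy (λ n → x n ℚ.+ y n)
+-cauchy x y cx cy ε 0<ε
  with cx (½ ℚ.* ε) (half-pos 0<ε) | cy (½ ℚ.* ε) (half-pos 0<ε)
... | M , hx | N , hy = M ℕ.⊔ N , λ m n M⊔N≤m M⊔N≤n → begin
  ℚ.∣ (x m ℚ.+ y m) ℚ.- (x n ℚ.+ y n) ∣
    ≡⟨ cong ℚ.∣_∣ (interchange (x m) (y m) (x n) (y n)) ⟩
  ℚ.∣ (x m ℚ.- x n) ℚ.+ (y m ℚ.- y n) ∣
    ≤⟨ ℚ.∣p+q∣≤∣p∣+∣q∣ (x m ℚ.- x n) (y m ℚ.- y n) ⟩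
  ℚ.∣ x m ℚ.- x n ∣ ℚ.+ ℚ.∣ y m ℚ.- y n ∣
    ≤⟨ ℚ.+-mono-≤
         (hx m n (ℕ.m⊔n≤o⇒m≤o M N M⊔N≤m) (ℕ.m⊔n≤o⇒m≤o M N M⊔N≤n))
         (hy m n (ℕ.m⊔n≤o⇒n≤o M N M⊔N≤m) (ℕ.m⊔n≤o⇒n≤o M N M⊔N≤n)) ⟩
  ½ ℚ.* ε ℚ.+ ½ ℚ.* ε
    ≡⟨ half+half ε ⟩
  ε ∎
  where open ℚ.≤-Reasoning

⊔-cauchy : ∀ x y → IsCauchy x → IsCauchy y → IsCauchy (λ n → x n ℚ.⊔ y n)
⊔-cauchy x y cx cy ε 0<ε with cx ε 0<ε | cy ε 0<ε
... | M , hx | N , hy = M ℕ.⊔ N , λ m n M⊔N≤m M⊔N≤n →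
  let hx′ = hx m n (ℕ.m⊔n≤o⇒m≤o M N M⊔N≤m) (ℕ.m⊔n≤o⇒m≤o M N M⊔N≤n)
      hy′ = hy m n (ℕ.m⊔n≤o⇒n≤o M N M⊔N≤m) (ℕ.m⊔n≤o⇒n≤o M N M⊔N≤n)
  in both⇒∣-∣≤ (x m ℚ.⊔ y m) (x n ℚ.⊔ y n)
       (⊔-sub-≤ (x m) (y m) (x n) (y n) hx′ hy′)
       (⊔-sub-≤ (x n) (y n) (x m) (y m)
                (subst (ℚ._≤ ε) (∣-∣-sym (x m) (x n)) hx′)
                (subst (ℚ._≤ ε) (∣-∣-sym (y m) (y n)) hy′))

1+∣_∣ : ℚ → ℚ
1+∣ c ∣ = 1ℚ ℚ.+ ℚ.∣ c ∣

1+∣-∣-pos : ∀ c → ℚ.Positive 1+∣ c ∣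
1+∣-∣-pos c = ℚ.positive (ℚ.+-mono-<-≤ (ℚ.positive⁻¹ 1ℚ) (ℚ.0≤∣p∣ c))

∣c∣≤1+∣c∣ : ∀ c → ℚ.∣ c ∣ ℚ.≤ 1+∣ c ∣
∣c∣≤1+∣c∣ c = subst (ℚ._≤ 1+∣ c ∣) (ℚ.+-identityˡ ℚ.∣ c ∣)
  (ℚ.+-monoˡ-≤ ℚ.∣ c ∣ (ℚ.<⇒≤ (ℚ.positive⁻¹ 1ℚ)))

·-cauchy : ∀ c x → IsCauchy x → IsCauchy (λ n → c ℚ.* x n)
·-cauchy c x cx ε 0<ε = N , λ m n N≤m N≤n → begin
  ℚ.∣ c ℚ.* x m ℚ.- c ℚ.* x n ∣
    ≡⟨ cong ℚ.∣_∣ (*-sub c (x m) (x n)) ⟩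
  ℚ.∣ c ℚ.* (x m ℚ.- x n) ∣
    ≡⟨ ℚ.∣p*q∣≡∣p∣*∣q∣ c (x m ℚ.- x n) ⟩
  ℚ.∣ c ∣ ℚ.* ℚ.∣ x m ℚ.- x n ∣
    ≤⟨ ℚ.*-monoʳ-≤-nonNeg ℚ.∣ x m ℚ.- x n ∣
         {{ℚ.nonNegative (ℚ.0≤∣p∣ (x m ℚ.- x n))}} (∣c∣≤1+∣c∣ c) ⟩
  k ℚ.* ℚ.∣ x m ℚ.- x n ∣
    ≤⟨ ℚ.*-monoˡ-≤-nonNeg k {{ℚ.pos⇒nonNeg k {{k-pos}}}} (hx m n N≤m N≤n) ⟩
  k ℚ.* (1/ k ℚ.* ε)
    ≡⟨ sym (ℚ.*-assoc k (1/ k) ε) ⟩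
  k ℚ.* 1/ k ℚ.* ε
    ≡⟨ cong (ℚ._* ε) (ℚ.*-inverseʳ k) ⟩
  1ℚ ℚ.* ε
    ≡⟨ ℚ.*-identityˡ ε ⟩
  ε ∎
  where
  open ℚ.≤-Reasoning
  k : ℚ
  k = 1+∣ c ∣
  k-pos : ℚ.Positive k
  k-pos = 1+∣-∣-pos c
  instance
    k-nonZero : ℚ.NonZero k
    k-nonZero = ℚ.pos⇒nonZero k {{k-pos}}
  δ>0 : 0ℚ ℚ.< 1/ k ℚ.* ε
  δ>0 = subst (ℚ._< 1/ k ℚ.* ε) (ℚ.*-zeroʳ (1/ k))
    (ℚ.*-monoʳ-<-pos (1/ k) {{ℚ.1/pos⇒pos k {{k-pos}}}} 0<ε)
  N  = proj₁ (cx (1/ k ℚ.* ε) δ>0)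
  hx = proj₂ (cx (1/ k ℚ.* ε) δ>0)

infixl 6 _+_ _⊔_
infixl 7 _·_

0ℝ : ℝ
0ℝ = mkℝ (λ _ → 0ℚ) (λ ε 0<ε → 0 , λ _ _ _ _ → ℚ.<⇒≤ 0<ε)

_+_ : ℝ → ℝ → ℝ
x + y = mkℝ (λ n → seq x n ℚ.+ seq y n) (+-cauchy (seq x) (seq y) (cauchy x) (cauchy y))

_⊔_ : ℝ → ℝ → ℝ
x ⊔ y = mkℝ (λ n → seq x n ℚ.⊔ seq y n) (⊔-cauchy (seq x) (seq y) (cauchy x) (cauchy y))

_·_ : ℚ → ℝ → ℝ
c · x = mkℝ (λ n → c ℚ.* seq x n) (·-cauchy c (seq x) (cauchy x))

∑ : ∀ {n} → Vector ℝ n → ℝ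
∑ = foldr _+_ 0ℝ

max : ∀ {n} → (Subset n → ℝ) → ℝ
max {zero}  f = f []
max {suc n} f = max (f ∘ (true ∷_)) ⊔ max (f ∘ (false ∷_))

-- The argument of type Arc u v of weight is irrelevant: an arc is
-- determined by its two ends, as there are no parallel arcs.

record WeightedDigraph (n : ℕ) : Set₁ where
  field
    Arc       : Rel (Fin n) 0ℓ
    arc?      : Decidable Arc
    loopless  : Irreflexive _≡_ Arc
    weight    : ∀ u v → .(Arc u v) → ℝ
    weight-≥0 : ∀ u v .(a : Arc u v) → weight u v a ≥ 0ℝ

module _ {n : ℕ} (D : WeightedDigraph n) where
  open WeightedDigraph D

  weight₀ : Fin n → Fin n → ℝ
  weight₀ u v with arc? u v
  ... | yes a = weight u v a
  ... | no  _ = 0ℝ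

  totalWeight : ℝ
  totalWeight = ∑ λ u → ∑ λ v → weight₀ u v

  weightFromTo : Subset n → Subset n → ℝ
  weightFromTo X Y = ∑ λ u → ∑ λ v →
    if does (u ∈? X ×-dec v ∈? Y) then weight₀ u v else 0ℝ

  -- Partitions (X , Y) correspond to subsets X, with Y = ∁ X; either part
  -- may be empty.

  mac : ℝ
  mac = max λ X → weightFromTo X (∁ X)

  IsPath : List (Fin n) → Set
  IsPath p = Linked Arc p × Unique p

  IsLongestPathOrder : ℕ → Set
  IsLongestPathOrder ν =
    (∃[ p ] IsPath p × length p ≡ ν) ×
    (∀ p → IsPath p → length p ℕ.≤ ν)

1/4[_] : (i : ℤ) → i ≢ + 0 → ℚ
1/4[ i ] i≢0 = (1/ ((+ 4 ℤ.* i) / 1)) {{ℚ.≢-nonZero 4i/1≢0}}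
  where
  4i/1≢0 : (+ 4 ℤ.* i) / 1 ≢ 0ℚ
  4i/1≢0 eq with ℚ./-injective-≃ (ℚᵘ.mkℚᵘ (+ 4 ℤ.* i) 0) ℚᵘ.0ℚᵘ eq
  ... | *≡* e
      with ℤ.i*j≡0⇒i≡0∨j≡0 (+ 4) (trans (sym (ℤ.*-identityʳ (+ 4 ℤ.* i))) e)
  ...   | inj₂ i≡0 = i≢0 i≡0

odd⇒ν≢0 : ∀ {ν} → 2 ∤ ν → + ν ≢ + 0
odd⇒ν≢0 2∤ν refl = 2∤ν (2 ∣0)

-- The difference is taken in ℤ, so that ν = 0 (the digraph without
-- vertices) is covered too, with coefficient 1/4 + 1/(4 · (-1)) = 0.

even⇒ν-1≢0 : ∀ {ν} → 2 ∣ ν → + ν ℤ.- + 1 ≢ + 0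
even⇒ν-1≢0 {ν} 2∣ν eq
  with refl ← ℤ.+-injective (ℤ.i-j≡0⇒i≡j (+ ν) (+ 1) eq)
  with () ← ∣1⇒≡1 2∣ν

{-# OPTIONS --safe #-}
-- Gallai–Roy: start from the labelling that is 0 everywhere and, as long as some arc
-- u → v joins equal labels, raise by one the labels of v and of all vertices that
-- depend on v.  Every vertex labelled k + 1 keeps an in-neighbour labelled k, so a
-- vertex labelled k ends a path with k + 1 vertices; hence labels stay below ν and the
-- process ends with a proper colouring, using at most 2m + 2 colours, where ν is
-- 2m + 1 or 2m + 2.  Now average the cuts over all sets of m + 1 out of 2m + 2 colours:
-- each arc is cut C(2m, m) times out of C(2m + 2, m + 1), and the quotient is
-- (m + 1) / (2 (2m + 1)) = 1/4 + 1/(4 (2m + 1)).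
module Submission where

open import Data.Bool.Base using (if_then_else_; not; _∧_)
open import Data.Bool.Properties using (∧-identityʳ; ∧-zeroʳ)
open import Data.Fin.Base using (Fin; zero; suc; fromℕ<)
import Data.Fin.Properties as Fin
open import Data.Fin.Subset using (Subset; inside; outside; ⊥; ∁)
open import Data.Fin.Subset.Properties using (_∈?_)
open import Data.Integer.Base as ℤ using (+_)
import Data.Integer.Properties as ℤ
open import Data.List.Base using (List; []; _∷_; length)
open import Data.List.Relation.Unary.All as All using (All; []; _∷_)
open import Data.List.Relation.Unary.AllPairs using ([]; _∷_)
open import Data.List.Relation.Unary.Linked using (Linked; [-]; _∷_)
open import Data.List.Relation.Unary.Unique.Propositional using (Unique)
open import Data.Nat.Base as ℕ using (ℕ; zero; suc)
open import Data.Nat.Combinatorics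
  using (_C_; nCk≡nC[n∸k]; nCk+nC[k+1]≡[n+1]C[k+1]; k>n⇒nCk≡0)
open import Data.Nat.Divisibility using (_∣_; _∤_; divides; m%n≡0⇒n∣m)
open import Data.Nat.DivMod using (_%_; m≡m%n+[m/n]*n; m%n<n)
import Data.Nat.Properties as ℕ
open import Data.Nat.Tactic.RingSolver using (solve-∀)
open import Data.Product.Base using (_×_; _,_; ∃-syntax)
open import Data.Rational.Base as ℚ using (ℚ; 0ℚ; 1ℚ; _/_; toℚᵘ; fromℚᵘ)
import Data.Rational.Properties as ℚ
open import Data.Rational.Solver using (module +-*-Solver)
open import Data.Rational.Unnormalised.Base as ℚᵘ using (*≡*; mkℚᵘ)
import Data.Rational.Unnormalised.Properties as ℚᵘ
open import Data.Vec.Base using ([]; _∷_; lookup; tabulate)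
open import Data.Vec.Properties using (lookup-replicate; lookup-map; lookup∘tabulate)
open import Defs
open import Function.Base using (_∘_)
open import Level using (0ℓ)
open import Relation.Binary.Core using (Rel)
open import Relation.Binary.Definitions using (Decidable)
open import Relation.Binary.PropositionalEquality
  using (_≡_; _≢_; refl; sym; trans; cong; cong₂; subst; module ≡-Reasoning)
open import Relation.Nullary using (¬_; Dec; yes; no; does; contradiction)
open import Relation.Nullary.Decidable using (_×-dec_; map′)

open import Algebra.Properties.CommutativeMonoid.Sum ℕ.+-0-commutativeMonoid using (sum)

-- Gallai–Roy colouring

sum-mono-≤ : ∀ {n} {f g : Fin n → ℕ} → (∀ i → f i ℕ.≤ g i) → sum f ℕ.≤ sum g
sum-mono-≤ {zero}  f≤g = ℕ.z≤n
sum-mono-≤ {suc n} f≤g = ℕ.+-mono-≤ (f≤g zero) (sum-mono-≤ (f≤g ∘ suc))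

sum-mono-< : ∀ {n} {f g : Fin n → ℕ} → (∀ i → f i ℕ.≤ g i) →
             ∀ j → f j ℕ.< g j → sum f ℕ.< sum g
sum-mono-< f≤g zero    fj<gj = ℕ.+-mono-<-≤ fj<gj (sum-mono-≤ (f≤g ∘ suc))
sum-mono-< f≤g (suc j) fj<gj = ℕ.+-mono-≤-< (f≤g zero) (sum-mono-< (f≤g ∘ suc) j fj<gj)

sum-≤-* : ∀ {n b} {f : Fin n → ℕ} → (∀ i → f i ℕ.≤ b) → sum f ℕ.≤ n ℕ.* b
sum-≤-* {zero}  f≤b = ℕ.z≤n
sum-≤-* {suc n} f≤b = ℕ.+-mono-≤ (f≤b zero) (sum-≤-* (f≤b ∘ suc))

module _ {n} {Arc : Rel (Fin n) 0ℓ} (arc? : Decidable Arc) where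

  Supported : (Fin n → ℕ) → Set
  Supported f = ∀ v {k} → f v ≡ suc k → ∃[ u ] Arc u v × f u ≡ k

  Proper : (Fin n → ℕ) → Set
  Proper f = ∀ u v → Arc u v → f u ≢ f v

  module _ {f : Fin n → ℕ} (supported : Supported f) where

    -- The path grows backwards from `x` through supporting in-neighbours. Each added vertex has a
    -- smaller label than all the others, so no vertex repeats.
    extend-path : ∀ k x p → f x ≡ k → Linked Arc (x ∷ p) → Unique (x ∷ p) →
      All (λ y → f x ℕ.< f y) p →
      ∃[ q ] (Linked Arc q × Unique q) × length q ≡ suc (length p) ℕ.+ k
    extend-path zero x p fx≡k linked unique above =
      x ∷ p , (linked , unique) , sym (ℕ.+-identityʳ _)
    extend-path (suc k) x p fx≡1+k linked unique above
      with u , u→x , fu≡k ← supported x fx≡1+k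
      = let fu<fx = ℕ.≤-reflexive (trans (cong suc fu≡k) (sym fx≡1+k))
            above′ = fu<fx ∷ All.map (ℕ.<-trans fu<fx) above
            q , path , len = extend-path k u (x ∷ p) fu≡k (u→x ∷ linked)
              (All.map (λ fu<fy u≡y → ℕ.<⇒≢ fu<fy (cong f u≡y)) above′ ∷ unique) above′
        in q , path , trans len (sym (ℕ.+-suc (suc (length p)) k))

    path-to : ∀ x → ∃[ q ] (Linked Arc q × Unique q) × length q ≡ suc (f x)
    path-to x = extend-path (f x) x [] refl [-] ([] ∷ []) []

  -- Raising `v` may take the support from the heads of tight arcs out of `v`; raising those affects
  -- further heads, and so on. This is the closure that has to be raised together.
  data TightReach (f : Fin n → ℕ) (v : Fin n) : Fin n → Set where
    here : TightReach f v v
    step : ∀ {x y} → TightReach f v x → Arc x y → f y ≡ suc (f x) → TightReach f v y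

  label-≤ : ∀ {f v x} → TightReach f v x → f v ℕ.≤ f x
  label-≤ here              = ℕ.≤-refl
  label-≤ (step r _ fy≡1+fx) =
    ℕ.≤-trans (label-≤ r) (ℕ.≤-trans (ℕ.n≤1+n _) (ℕ.≤-reflexive (sym fy≡1+fx)))

  -- Labels grow by one on each tight arc, so a nonempty tight walk ends strictly above `f v`.
  label≡⇒source : ∀ {f v x} → TightReach f v x → f x ≡ f v → x ≡ v
  label≡⇒source here _ = refl
  label≡⇒source (step r _ fy≡1+fx) fy≡fv = contradiction
    (ℕ.≤-trans (ℕ.≤-reflexive (sym fy≡1+fx)) (ℕ.≤-trans (ℕ.≤-reflexive fy≡fv) (label-≤ r)))
    (ℕ.<-irrefl refl)

  -- The last arc of a tight walk into `x` leaves a vertex labelled one less, so the search recurses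
  -- on the label. It is the separate argument `k` to make this recursion structural.
  tightReach? : ∀ f v k x → f x ≡ k → Dec (TightReach f v x)
  tightReach? f v zero x fx≡0 = map′ (λ { refl → here })
    (λ { here → refl ; (step _ _ e) → contradiction (trans (sym fx≡0) e) λ () }) (x Fin.≟ v)
  tightReach? f v (suc k) x fx≡1+k with x Fin.≟ v
  ... | yes refl = yes here
  ... | no  x≢v  = map′
    (λ { (y , y→x , fy≡k , r) → step r y→x (trans fx≡1+k (cong suc (sym fy≡k))) })
    (λ { here → contradiction refl x≢v
       ; (step {y} r y→x e) → y , y→x , ℕ.suc-injective (trans (sym e) fx≡1+k) , r })
    (Fin.any? λ y → arc? y x ×-dec reach? y)
    where
    reach? : ∀ y → Dec (f y ≡ k × TightReach f v y)
    reach? y with f y ℕ.≟ k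
    ... | no  fy≢k = no λ (fy≡k , _) → fy≢k fy≡k
    ... | yes fy≡k = map′ (fy≡k ,_) (λ (_ , r) → r) (tightReach? f v k y fy≡k)

  module _ (f : Fin n → ℕ) (v : Fin n) where

    raise : Fin n → ℕ
    raise x = if does (tightReach? f v (f x) x refl) then suc (f x) else f x

    raise-reach : ∀ {x} → TightReach f v x → raise x ≡ suc (f x)
    raise-reach {x} r with tightReach? f v (f x) x refl
    ... | yes _ = refl
    ... | no ¬r = contradiction r ¬r

    raise-unreach : ∀ {x} → ¬ TightReach f v x → raise x ≡ f x
    raise-unreach {x} ¬r with tightReach? f v (f x) x refl
    ... | yes r = contradiction r ¬r
    ... | no  _ = refl

    ≤-raise : ∀ x → f x ℕ.≤ raise x
    ≤-raise x with tightReach? f v (f x) x refl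
    ... | yes _ = ℕ.n≤1+n _
    ... | no  _ = ℕ.≤-refl

    -- u still supports v: among the raised vertices only v has label f v.
    raise-supported : ∀ {u} → Supported f → Arc u v → u ≢ v → f u ≡ f v → Supported raise
    raise-supported {u} supported u→v u≢v fu≡fv x {k} eq
      with tightReach? f v (f x) x refl
    ... | yes here = u , u→v , trans (raise-unreach (λ r → u≢v (label≡⇒source r fu≡fv)))
                                     (trans fu≡fv (ℕ.suc-injective eq))
    -- Both ends of a tight arc are raised, so `y` still supports `x`.
    ... | yes (step {y} r y→x fx≡1+fy) =
          y , y→x , trans (raise-reach r) (trans (sym fx≡1+fy) (ℕ.suc-injective eq))
    -- If the old supporter `y` were raised, its arc to `x` would be tight and `x` would be raised
    -- too.
    ... | no ¬r with y , y→x , fy≡k ← supported x eq =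
          y , y→x , trans
            (raise-unreach λ r → ¬r (step r y→x (trans eq (cong suc (sym fy≡k))))) fy≡k

  module _ {ν : ℕ}
    (loopless : ∀ {v} → ¬ Arc v v)
    (longest : ∀ p → Linked Arc p × Unique p → length p ℕ.≤ ν) where

    supported-< : ∀ {f} → Supported f → ∀ v → f v ℕ.< ν
    supported-< supported v with q , path , len ← path-to supported v =
      subst (ℕ._≤ ν) len (longest q path)

    -- Labels stay below ν, so g bounds the number of further raises.
    improve : ∀ g {f} → Supported f → n ℕ.* ν ℕ.≤ g ℕ.+ sum f →
              ∃[ f′ ] Supported f′ × Proper f′
    improve g {f} supported bound
      with Fin.any? (λ u → Fin.any? λ v → arc? u v ×-dec (f u ℕ.≟ f v))
    ... | no  none = f , supported , λ u v u→v fu≡fv → none (u , v , u→v , fu≡fv)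
    ... | yes (u , v , u→v , fu≡fv) = next g bound
      where
      supported′ : Supported (raise f v)
      supported′ = raise-supported f v supported u→v (λ { refl → loopless u→v }) fu≡fv
      increase : sum f ℕ.< sum (raise f v)
      increase = sum-mono-< (≤-raise f v) v (ℕ.≤-reflexive (sym (raise-reach f v here)))
      next : ∀ g → n ℕ.* ν ℕ.≤ g ℕ.+ sum f → ∃[ f′ ] Supported f′ × Proper f′
      -- With no raises left, `sum f` is already at least `n * ν`; the raised labels have a larger
      -- sum, although each is still below `ν`.
      next zero    b = contradiction
        (ℕ.<-≤-trans increase (ℕ.≤-trans (sum-≤-* (ℕ.<⇒≤ ∘ supported-< supported′)) b))
        (ℕ.<-irrefl refl)
      next (suc g) b = improve g supported′
        (ℕ.≤-trans b (ℕ.≤-trans (ℕ.≤-reflexive (sym (ℕ.+-suc g (sum f))))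
                                (ℕ.+-monoʳ-≤ g increase)))

    gallai-roy : ∃[ f ] (∀ v → f v ℕ.< ν) × Proper f
    -- The zero labelling is supported vacuously.
    gallai-roy with f , supported , proper ← improve (n ℕ.* ν) {λ _ → 0} (λ _ ()) (ℕ.m≤m+n _ _) =
      f , supported-< supported , proper

-- Binomial coefficients and naturals as rationals

-- Induction on `n`: Pascal's rule splits the left side into instances for `k` and `suc k`, with one
-- spare copy of `suc n C suc k` that raises the factor `suc n` to `suc (suc n)`.
absorption : ∀ n k → suc k ℕ.* (suc n C suc k) ≡ suc n ℕ.* (n C k)
absorption zero zero    = refl
absorption zero (suc k) = trans
  (cong (suc (suc k) ℕ.*_) (k>n⇒nCk≡0 {1} {suc (suc k)} (ℕ.s<s ℕ.z<s)))
  (ℕ.*-zeroʳ (suc (suc k)))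
absorption (suc n) zero = begin
  1 ℕ.* (suc (suc n) C 1)
    ≡⟨ cong (1 ℕ.*_) (nCk+nC[k+1]≡[n+1]C[k+1] (suc n) 0) ⟨
  1 ℕ.* (1 ℕ.+ (suc n C 1))
    ≡⟨ cong (λ a → 1 ℕ.* (1 ℕ.+ a)) (trans (sym (ℕ.*-identityˡ _)) (absorption n 0)) ⟩
  1 ℕ.* (1 ℕ.+ suc n ℕ.* 1)
    ≡⟨ lemma n ⟩
  suc (suc n) ℕ.* 1 ∎
  where
  open ≡-Reasoning
  lemma : ∀ n → 1 ℕ.* (1 ℕ.+ suc n ℕ.* 1) ≡ suc (suc n) ℕ.* 1
  lemma = solve-∀
absorption (suc n) (suc k) = begin
  suc (suc k) ℕ.* (suc (suc n) C suc (suc k))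
    ≡⟨ cong (suc (suc k) ℕ.*_) (nCk+nC[k+1]≡[n+1]C[k+1] (suc n) (suc k)) ⟨
  suc (suc k) ℕ.* ((suc n C suc k) ℕ.+ (suc n C suc (suc k)))
    ≡⟨ expand k (suc n C suc k) (suc n C suc (suc k)) ⟩
  (suc n C suc k) ℕ.+ (suc k ℕ.* (suc n C suc k) ℕ.+ suc (suc k) ℕ.* (suc n C suc (suc k)))
    ≡⟨ cong₂ (λ a b → (suc n C suc k) ℕ.+ (a ℕ.+ b)) (absorption n k) (absorption n (suc k)) ⟩
  (suc n C suc k) ℕ.+ (suc n ℕ.* (n C k) ℕ.+ suc n ℕ.* (n C suc k))
    ≡⟨ cong ((suc n C suc k) ℕ.+_) (trans (sym (ℕ.*-distribˡ-+ (suc n) (n C k) (n C suc k)))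
         (cong (suc n ℕ.*_) (nCk+nC[k+1]≡[n+1]C[k+1] n k))) ⟩
  suc (suc n) ℕ.* (suc n C suc k) ∎
  where
  open ≡-Reasoning
  expand : ∀ k a b → suc (suc k) ℕ.* (a ℕ.+ b) ≡ a ℕ.+ (suc k ℕ.* a ℕ.+ suc (suc k) ℕ.* b)
  expand = solve-∀

nCk>0 : ∀ {n k} → k ℕ.≤ n → 0 ℕ.< n C k
nCk>0 ℕ.z≤n = ℕ.z<s
nCk>0 {suc n} {suc k} (ℕ.s≤s k≤n) = subst (0 ℕ.<_) (nCk+nC[k+1]≡[n+1]C[k+1] n k)
  (ℕ.<-≤-trans (nCk>0 k≤n) (ℕ.m≤m+n (n C k) (n C suc k)))

-- The share of the balanced colour sets that cut a given arc, with denominators cleared. After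
-- absorption, the two equal middle coefficients of row `2m + 1` add up to the central one of row
-- `2m + 2`.
central-binomial : ∀ m →
  ((m ℕ.* 2) C m) ℕ.* (4 ℕ.* suc (m ℕ.* 2)) ≡
  suc (suc (m ℕ.* 2)) ℕ.* (suc (suc (m ℕ.* 2)) C suc m)
central-binomial m = begin
  (l C m) ℕ.* (4 ℕ.* suc l)                  ≡⟨ comm (l C m) (suc l) ⟩
  4 ℕ.* (suc l ℕ.* (l C m))                  ≡⟨ cong (4 ℕ.*_) (absorption l m) ⟨
  4 ℕ.* (suc m ℕ.* (suc l C suc m))          ≡⟨ regroup m (suc l C suc m) ⟩
  suc (suc l) ℕ.* ((suc l C suc m) ℕ.+ (suc l C suc m))
    ≡⟨ cong (λ a → suc (suc l) ℕ.* (a ℕ.+ (suc l C suc m))) middle ⟨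
  suc (suc l) ℕ.* ((suc l C m) ℕ.+ (suc l C suc m))
    ≡⟨ cong (suc (suc l) ℕ.*_) (nCk+nC[k+1]≡[n+1]C[k+1] (suc l) m) ⟩
  suc (suc l) ℕ.* (suc (suc l) C suc m)      ∎
  where
  open ≡-Reasoning
  l = m ℕ.* 2
  comm : ∀ a b → a ℕ.* (4 ℕ.* b) ≡ 4 ℕ.* (b ℕ.* a)
  comm = solve-∀
  regroup : ∀ m a → 4 ℕ.* (suc m ℕ.* a) ≡ suc (suc (m ℕ.* 2)) ℕ.* (a ℕ.+ a)
  regroup = solve-∀
  1+l≡m+1+m : suc l ≡ m ℕ.+ suc m
  1+l≡m+1+m = lemma m
    where lemma : ∀ m → suc (m ℕ.* 2) ≡ m ℕ.+ suc m
          lemma = solve-∀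
  middle : suc l C m ≡ suc l C suc m
  middle = trans (nCk≡nC[n∸k] (subst (m ℕ.≤_) (sym 1+l≡m+1+m) (ℕ.m≤m+n m (suc m))))
    (cong (suc l C_) (trans (cong (ℕ._∸ m) 1+l≡m+1+m) (ℕ.m+n∸m≡n m (suc m))))

fromℚᵘ-homo-+ : ∀ p q → fromℚᵘ (p ℚᵘ.+ q) ≡ fromℚᵘ p ℚ.+ fromℚᵘ q
fromℚᵘ-homo-+ p q = ℚ.toℚᵘ-injective (begin
  toℚᵘ (fromℚᵘ (p ℚᵘ.+ q))               ≈⟨ ℚ.toℚᵘ-fromℚᵘ (p ℚᵘ.+ q) ⟩
  p ℚᵘ.+ q                               ≈⟨ ℚᵘ.+-cong (ℚ.toℚᵘ-fromℚᵘ p) (ℚ.toℚᵘ-fromℚᵘ q) ⟨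
  toℚᵘ (fromℚᵘ p) ℚᵘ.+ toℚᵘ (fromℚᵘ q)   ≈⟨ ℚ.toℚᵘ-homo-+ (fromℚᵘ p) (fromℚᵘ q) ⟨
  toℚᵘ (fromℚᵘ p ℚ.+ fromℚᵘ q)           ∎)
  where open ℚᵘ.≃-Reasoning

fromℚᵘ-homo-* : ∀ p q → fromℚᵘ (p ℚᵘ.* q) ≡ fromℚᵘ p ℚ.* fromℚᵘ q
fromℚᵘ-homo-* p q = ℚ.toℚᵘ-injective (begin
  toℚᵘ (fromℚᵘ (p ℚᵘ.* q))               ≈⟨ ℚ.toℚᵘ-fromℚᵘ (p ℚᵘ.* q) ⟩
  p ℚᵘ.* q                               ≈⟨ ℚᵘ.*-cong (ℚ.toℚᵘ-fromℚᵘ p) (ℚ.toℚᵘ-fromℚᵘ q) ⟨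
  toℚᵘ (fromℚᵘ p) ℚᵘ.* toℚᵘ (fromℚᵘ q)   ≈⟨ ℚ.toℚᵘ-homo-* (fromℚᵘ p) (fromℚᵘ q) ⟨
  toℚᵘ (fromℚᵘ p ℚ.* fromℚᵘ q)           ∎)
  where open ℚᵘ.≃-Reasoning

fromℕ : ℕ → ℚ
fromℕ n = + n / 1

-- `fromℚᵘ (mkℚᵘ (+ n) 0)` computes to `fromℕ n`, so it suffices to compare unnormalised fractions,
-- that is, numerators.
fromℕ-homo-+ : ∀ m n → fromℕ (m ℕ.+ n) ≡ fromℕ m ℚ.+ fromℕ n
fromℕ-homo-+ m n = trans
  (ℚ.fromℚᵘ-cong {mkℚᵘ (+ (m ℕ.+ n)) 0} {mkℚᵘ (+ m) 0 ℚᵘ.+ mkℚᵘ (+ n) 0}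
    (*≡* (cong (ℤ._* + 1) (trans (ℤ.pos-+ m n)
      (sym (cong₂ ℤ._+_ (ℤ.*-identityʳ (+ m)) (ℤ.*-identityʳ (+ n))))))))
  (fromℚᵘ-homo-+ (mkℚᵘ (+ m) 0) (mkℚᵘ (+ n) 0))

fromℕ-homo-* : ∀ m n → fromℕ (m ℕ.* n) ≡ fromℕ m ℚ.* fromℕ n
fromℕ-homo-* m n = trans
  (ℚ.fromℚᵘ-cong {mkℚᵘ (+ (m ℕ.* n)) 0} {mkℚᵘ (+ m) 0 ℚᵘ.* mkℚᵘ (+ n) 0}
    (*≡* (cong (ℤ._* + 1) (ℤ.pos-* m n))))
  (fromℚᵘ-homo-* (mkℚᵘ (+ m) 0) (mkℚᵘ (+ n) 0))

fromℕ-positive : ∀ {n} → 0 ℕ.< n → ℚ.Positive (fromℕ n)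
fromℕ-positive {suc n} _ = ℚ.normalize-pos (suc n) 1

1/4[]-spec : ∀ n (n≢0 : + suc n ≢ + 0) → fromℕ (4 ℕ.* suc n) ℚ.* 1/4[ + suc n ] n≢0 ≡ 1ℚ
1/4[]-spec n n≢0 = ℚ.*-inverseʳ (fromℕ (4 ℕ.* suc n))
  {{ℚ.pos⇒nonZero (fromℕ (4 ℕ.* suc n)) {{fromℕ-positive {4 ℕ.* suc n} ℕ.z<s}}}}

-- For `n = 2m` this fixes the coefficient of the theorem as `(2m + 2) / (4 (2m + 1))`. The integer
-- `i` is tied to `suc n` by an equation only, so that it can be `+ ν` or `+ ν ℤ.- + 1`.
coefficient : ∀ n {i} → i ≡ + suc n → (i≢0 : i ≢ + 0) →
  fromℕ (4 ℕ.* suc n) ℚ.* (+ 1 / 4 ℚ.+ 1/4[ i ] i≢0) ≡ fromℕ (suc (suc n))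
coefficient n refl n≢0 = begin
  q ℚ.* (+ 1 / 4 ℚ.+ r)                ≡⟨ ℚ.*-distribˡ-+ q (+ 1 / 4) r ⟩
  q ℚ.* (+ 1 / 4) ℚ.+ q ℚ.* r          ≡⟨ cong₂ ℚ._+_ quarter (1/4[]-spec n n≢0) ⟩
  fromℕ (suc n) ℚ.+ 1ℚ                 ≡⟨ ℚ.+-comm (fromℕ (suc n)) 1ℚ ⟩
  fromℕ 1 ℚ.+ fromℕ (suc n)            ≡⟨ fromℕ-homo-+ 1 (suc n) ⟨
  fromℕ (suc (suc n))                  ∎
  where
  open ≡-Reasoning
  q = fromℕ (4 ℕ.* suc n)
  r = 1/4[ + suc n ] n≢0
  quarter : q ℚ.* (+ 1 / 4) ≡ fromℕ (suc n)
  quarter = begin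
    q ℚ.* (+ 1 / 4)                          ≡⟨ cong (ℚ._* (+ 1 / 4)) (fromℕ-homo-* 4 (suc n)) ⟩
    fromℕ 4 ℚ.* fromℕ (suc n) ℚ.* (+ 1 / 4)  ≡⟨ cong (ℚ._* (+ 1 / 4)) (ℚ.*-comm (fromℕ 4) (fromℕ (suc n))) ⟩
    fromℕ (suc n) ℚ.* fromℕ 4 ℚ.* (+ 1 / 4)  ≡⟨ ℚ.*-assoc (fromℕ (suc n)) (fromℕ 4) (+ 1 / 4) ⟩
    fromℕ (suc n) ℚ.* 1ℚ                     ≡⟨ ℚ.*-identityʳ (fromℕ (suc n)) ⟩
    fromℕ (suc n)                            ∎

-- Averaging over colour sets

-- Branching on the first element mirrors Pascal's rule, so the counts below are inductions closed
-- by `pascal`.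
∑ofSize : (k h : ℕ) → (Subset k → ℚ) → ℚ
∑ofSize zero    zero    F = F []
∑ofSize zero    (suc h) F = 0ℚ
∑ofSize (suc k) zero    F = ∑ofSize k zero (F ∘ (outside ∷_))
∑ofSize (suc k) (suc h) F = ∑ofSize k h (F ∘ (inside ∷_)) ℚ.+ ∑ofSize k (suc h) (F ∘ (outside ∷_))

∑ofSize-cong : ∀ k h {F G : Subset k → ℚ} → (∀ T → F T ≡ G T) → ∑ofSize k h F ≡ ∑ofSize k h G
∑ofSize-cong zero    zero    F≗G = F≗G []
∑ofSize-cong zero    (suc h) F≗G = refl
∑ofSize-cong (suc k) zero    F≗G = ∑ofSize-cong k zero (F≗G ∘ (outside ∷_))
∑ofSize-cong (suc k) (suc h) F≗G = cong₂ ℚ._+_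
  (∑ofSize-cong k h (F≗G ∘ (inside ∷_))) (∑ofSize-cong k (suc h) (F≗G ∘ (outside ∷_)))

∑ofSize-+ : ∀ k h (F G : Subset k → ℚ) →
  ∑ofSize k h (λ T → F T ℚ.+ G T) ≡ ∑ofSize k h F ℚ.+ ∑ofSize k h G
∑ofSize-+ zero    zero    F G = refl
∑ofSize-+ zero    (suc h) F G = refl
∑ofSize-+ (suc k) zero    F G = ∑ofSize-+ k zero (F ∘ (outside ∷_)) (G ∘ (outside ∷_))
∑ofSize-+ (suc k) (suc h) F G = trans
  (cong₂ ℚ._+_ (∑ofSize-+ k h (F ∘ (inside ∷_)) (G ∘ (inside ∷_)))
               (∑ofSize-+ k (suc h) (F ∘ (outside ∷_)) (G ∘ (outside ∷_))))
  (+-interchange (∑ofSize k h (F ∘ (inside ∷_))) (∑ofSize k h (G ∘ (inside ∷_)))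
                 (∑ofSize k (suc h) (F ∘ (outside ∷_))) (∑ofSize k (suc h) (G ∘ (outside ∷_))))
  where
  open +-*-Solver
  +-interchange : ∀ p q r s → (p ℚ.+ q) ℚ.+ (r ℚ.+ s) ≡ (p ℚ.+ r) ℚ.+ (q ℚ.+ s)
  +-interchange = solve 4 (λ p q r s → (p :+ q) :+ (r :+ s) := (p :+ r) :+ (q :+ s)) refl

∑ofSize-empty : ∀ k (F : Subset k → ℚ) → ∑ofSize k 0 F ≡ F ⊥
∑ofSize-empty zero    F = refl
∑ofSize-empty (suc k) F = ∑ofSize-empty k (F ∘ (outside ∷_))

pascal : ∀ n k q →
  fromℕ (n C k) ℚ.* q ℚ.+ fromℕ (n C suc k) ℚ.* q ≡ fromℕ (suc n C suc k) ℚ.* q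
pascal n k q = begin
  fromℕ (n C k) ℚ.* q ℚ.+ fromℕ (n C suc k) ℚ.* q
    ≡⟨ ℚ.*-distribʳ-+ q (fromℕ (n C k)) (fromℕ (n C suc k)) ⟨
  (fromℕ (n C k) ℚ.+ fromℕ (n C suc k)) ℚ.* q
    ≡⟨ cong (ℚ._* q) (fromℕ-homo-+ (n C k) (n C suc k)) ⟨
  fromℕ ((n C k) ℕ.+ (n C suc k)) ℚ.* q
    ≡⟨ cong (λ a → fromℕ a ℚ.* q) (nCk+nC[k+1]≡[n+1]C[k+1] n k) ⟩
  fromℕ (suc n C suc k) ℚ.* q ∎
  where open ≡-Reasoning

∑ofSize-const : ∀ k h q → ∑ofSize k h (λ _ → q) ≡ fromℕ (k C h) ℚ.* q
∑ofSize-const zero    zero    q = sym (ℚ.*-identityˡ q)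
∑ofSize-const zero    (suc h) q = sym (trans
  (cong (λ a → fromℕ a ℚ.* q) (k>n⇒nCk≡0 {0} {suc h} ℕ.z<s))
  (ℚ.*-zeroˡ q))
∑ofSize-const (suc k) zero    q = ∑ofSize-const k zero q
∑ofSize-const (suc k) (suc h) q =
  trans (cong₂ ℚ._+_ (∑ofSize-const k h q) (∑ofSize-const k (suc h) q)) (pascal k h q)

∑ofSize-0 : ∀ k h → ∑ofSize k h (λ _ → 0ℚ) ≡ 0ℚ
∑ofSize-0 k h = trans (∑ofSize-const k h 0ℚ) (ℚ.*-zeroʳ (fromℕ (k C h)))

∑ofSize-mono-≤ : ∀ k h {F G : Subset k → ℚ} → (∀ T → F T ℚ.≤ G T) → ∑ofSize k h F ℚ.≤ ∑ofSize k h G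
∑ofSize-mono-≤ zero    zero    F≤G = F≤G []
∑ofSize-mono-≤ zero    (suc h) F≤G = ℚ.≤-refl
∑ofSize-mono-≤ (suc k) zero    F≤G = ∑ofSize-mono-≤ k zero (F≤G ∘ (outside ∷_))
∑ofSize-mono-≤ (suc k) (suc h) F≤G = ℚ.+-mono-≤
  (∑ofSize-mono-≤ k h (F≤G ∘ (inside ∷_))) (∑ofSize-mono-≤ k (suc h) (F≤G ∘ (outside ∷_)))

-- With `i` chosen, the other `h` elements come from the remaining `k`.
∑ofSize-∈ : ∀ k h (i : Fin (suc k)) q →
  ∑ofSize (suc k) (suc h) (λ T → if lookup T i then q else 0ℚ) ≡ fromℕ (k C h) ℚ.* q
∑ofSize-∈ k h zero q = trans
  (cong₂ ℚ._+_ (∑ofSize-const k h q) (∑ofSize-0 k (suc h))) (ℚ.+-identityʳ _)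
-- In size one, choosing the first element leaves no room for `i`, so that branch contributes
-- nothing.
∑ofSize-∈ (suc k) zero (suc i) q = trans
  (cong₂ ℚ._+_
    (trans (∑ofSize-empty (suc k) (λ T → if lookup T i then q else 0ℚ))
           (cong (if_then q else 0ℚ) (lookup-replicate i outside)))
    (∑ofSize-∈ k zero i q))
  (ℚ.+-identityˡ _)
∑ofSize-∈ (suc k) (suc h) (suc i) q =
  trans (cong₂ ℚ._+_ (∑ofSize-∈ k h i q) (∑ofSize-∈ k (suc h) i q)) (pascal k h q)

∑ofSize-∉ : ∀ k h (i : Fin (suc k)) q →
  ∑ofSize (suc k) h (λ T → if not (lookup T i) then q else 0ℚ) ≡ fromℕ (k C h) ℚ.* q
∑ofSize-∉ k       zero    zero    q = ∑ofSize-const k zero q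
∑ofSize-∉ k       (suc h) zero    q = trans
  (cong₂ ℚ._+_ (∑ofSize-0 k h) (∑ofSize-const k (suc h) q)) (ℚ.+-identityˡ _)
∑ofSize-∉ (suc k) zero    (suc i) q = ∑ofSize-∉ k zero i q
∑ofSize-∉ (suc k) (suc h) (suc i) q =
  trans (cong₂ ℚ._+_ (∑ofSize-∉ k h i q) (∑ofSize-∉ k (suc h) i q)) (pascal k h q)

-- With `i` in and `j` out, `h` elements are chosen freely from the other `k`. Recursion stops when
-- `i` or `j` comes first, leaving a condition on one element.
∑ofSize-∈-∉ : ∀ k h (i j : Fin (suc (suc k))) q → i ≢ j →
  ∑ofSize (suc (suc k)) (suc h) (λ T → if lookup T i ∧ not (lookup T j) then q else 0ℚ) ≡
  fromℕ (k C h) ℚ.* q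
∑ofSize-∈-∉ k h zero zero q i≢j = contradiction refl i≢j
∑ofSize-∈-∉ k h zero (suc j) q i≢j = trans
  (cong₂ ℚ._+_ (∑ofSize-∉ k h j q) (∑ofSize-0 (suc k) (suc h))) (ℚ.+-identityʳ _)
∑ofSize-∈-∉ k h (suc i) zero q i≢j = trans
  (cong₂ ℚ._+_
    (trans (∑ofSize-cong (suc k) h λ T → cong (if_then q else 0ℚ) (∧-zeroʳ (lookup T i)))
           (∑ofSize-0 (suc k) h))
    (trans (∑ofSize-cong (suc k) (suc h) λ T → cong (if_then q else 0ℚ) (∧-identityʳ (lookup T i)))
           (∑ofSize-∈ k h i q)))
  (ℚ.+-identityˡ _)
-- Two elements in all, neither of them first, must coincide.
∑ofSize-∈-∉ zero h (suc zero) (suc zero) q i≢j = contradiction refl i≢j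
∑ofSize-∈-∉ (suc k) zero (suc i) (suc j) q i≢j = trans
  (cong₂ ℚ._+_
    (trans (∑ofSize-empty (suc (suc k)) (λ T → if lookup T i ∧ not (lookup T j) then q else 0ℚ))
           (cong (λ b → if b ∧ not (lookup {n = suc (suc k)} ⊥ j) then q else 0ℚ)
                 (lookup-replicate i outside)))
    (∑ofSize-∈-∉ k zero i j q (i≢j ∘ cong suc)))
  (ℚ.+-identityˡ _)
∑ofSize-∈-∉ (suc k) (suc h) (suc i) (suc j) q i≢j = trans
  (cong₂ ℚ._+_ (∑ofSize-∈-∉ k h i j q (i≢j ∘ cong suc))
               (∑ofSize-∈-∉ k (suc h) i j q (i≢j ∘ cong suc)))
  (pascal k h q)

-- Linearity at a fixed index `t`, where `∑` computes to a sum of rationals. It is applied twice,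
-- for the tails and for the heads of arcs.
∑ofSize-∑ : ∀ {n} k h t a (x : Subset k → Fin n → ℝ) (y : Fin n → ℝ) →
  (∀ u → ∑ofSize k h (λ T → seq (x T u) t) ≡ a ℚ.* seq (y u) t) →
  ∑ofSize k h (λ T → seq (∑ (x T)) t) ≡ a ℚ.* seq (∑ y) t
∑ofSize-∑ {zero}  k h t a x y eq = trans (∑ofSize-0 k h) (sym (ℚ.*-zeroʳ a))
∑ofSize-∑ {suc n} k h t a x y eq = begin
  ∑ofSize k h (λ T → seq (x T zero) t ℚ.+ seq (∑ (x T ∘ suc)) t)
    ≡⟨ ∑ofSize-+ k h (λ T → seq (x T zero) t) (λ T → seq (∑ (x T ∘ suc)) t) ⟩
  ∑ofSize k h (λ T → seq (x T zero) t) ℚ.+ ∑ofSize k h (λ T → seq (∑ (x T ∘ suc)) t)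
    ≡⟨ cong₂ ℚ._+_ (eq zero) (∑ofSize-∑ k h t a (λ T → x T ∘ suc) (y ∘ suc) (eq ∘ suc)) ⟩
  a ℚ.* seq (y zero) t ℚ.+ a ℚ.* seq (∑ (y ∘ suc)) t
    ≡⟨ ℚ.*-distribˡ-+ a (seq (y zero) t) (seq (∑ (y ∘ suc)) t) ⟨
  a ℚ.* (seq (y zero) t ℚ.+ seq (∑ (y ∘ suc)) t) ∎
  where open ≡-Reasoning

-- Both `a` and `M / N` equal `B / A`; multiplying through by `A * N` avoids division.
scale-≤ : ∀ {A B M N a w x : ℚ} → ℚ.Positive A → ℚ.Positive N →
  A ℚ.* a ≡ B → M ℚ.* A ≡ B ℚ.* N → M ℚ.* w ℚ.≤ N ℚ.* x → a ℚ.* w ℚ.≤ x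
scale-≤ {A} {B} {M} {N} {a} {w} {x} A>0 N>0 Aa≡B MA≡BN Mw≤Nx =
  ℚ.*-cancelˡ-≤-pos (A ℚ.* N) {{ℚ.pos*pos⇒pos A {{A>0}} N {{N>0}}}} (begin
    A ℚ.* N ℚ.* (a ℚ.* w)  ≡⟨ shuffle A N a w ⟩
    A ℚ.* a ℚ.* N ℚ.* w    ≡⟨ cong (λ b → b ℚ.* N ℚ.* w) Aa≡B ⟩
    B ℚ.* N ℚ.* w          ≡⟨ cong (ℚ._* w) MA≡BN ⟨
    M ℚ.* A ℚ.* w          ≡⟨ trans (cong (ℚ._* w) (ℚ.*-comm M A)) (ℚ.*-assoc A M w) ⟩
    A ℚ.* (M ℚ.* w)        ≤⟨ ℚ.*-monoˡ-≤-nonNeg A {{ℚ.pos⇒nonNeg A {{A>0}}}} Mw≤Nx ⟩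
    A ℚ.* (N ℚ.* x)        ≡⟨ ℚ.*-assoc A N x ⟨
    A ℚ.* N ℚ.* x          ∎)
  where
  open ℚ.≤-Reasoning
  open +-*-Solver
  shuffle : ∀ p q r s → p ℚ.* q ℚ.* (r ℚ.* s) ≡ p ℚ.* r ℚ.* q ℚ.* s
  shuffle = solve 4 (λ p q r s → p :* q :* (r :* s) := p :* r :* q :* s) refl

-- Termwise inequalities between reals

-- All operations on reals involved act termwise, so the whole averaging argument can be run on
-- rationals at each index `t`.
seq-≤⇒≤ : ∀ x y → (∀ t → seq x t ℚ.≤ seq y t) → x ≤ y
seq-≤⇒≤ x y x≤y ε 0<ε = 0 , λ t _ → ℚ.≤-trans (x≤y t)
  (subst (ℚ._≤ seq y t ℚ.+ ε) (ℚ.+-identityʳ (seq y t)) (ℚ.+-monoʳ-≤ (seq y t) (ℚ.<⇒≤ 0<ε)))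

≤-max : ∀ {n} (x : Subset n → ℝ) X t → seq (x X) t ℚ.≤ seq (max x) t
≤-max x []            t = ℚ.≤-refl
≤-max x (inside  ∷ X) t = ℚ.≤-trans (≤-max (x ∘ (inside ∷_)) X t)
  (ℚ.p≤p⊔q (seq (max (x ∘ (inside ∷_))) t) (seq (max (x ∘ (outside ∷_))) t))
≤-max x (outside ∷ X) t = ℚ.≤-trans (≤-max (x ∘ (outside ∷_)) X t)
  (ℚ.p≤q⊔p (seq (max (x ∘ (inside ∷_))) t) (seq (max (x ∘ (outside ∷_))) t))

seq-if : ∀ b x t → seq (if b then x else 0ℝ) t ≡ (if b then seq x t else 0ℚ)
seq-if inside  x t = refl
seq-if outside x t = refl

does-∈? : ∀ {n} (u : Fin n) X → does (u ∈? X) ≡ lookup X u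
does-∈? zero    (inside  ∷ X) = refl
does-∈? zero    (outside ∷ X) = refl
does-∈? (suc u) (_ ∷ X)       = does-∈? u X

-- Cuts induced by sets of colours

module _ {n} (D : WeightedDigraph n) where
  open WeightedDigraph D

  module _ {k} (c : Fin n → Fin (suc (suc k))) (c-proper : ∀ u v → Arc u v → c u ≢ c v) where

    preimage : Subset (suc (suc k)) → Subset n
    preimage T = tabulate (lookup T ∘ c)

    crossing : ∀ T u v →
      does (u ∈? preimage T ×-dec v ∈? ∁ (preimage T)) ≡ lookup T (c u) ∧ not (lookup T (c v))
    crossing T u v = cong₂ _∧_
      (trans (does-∈? u (preimage T)) (lookup∘tabulate (lookup T ∘ c) u))
      (trans (does-∈? v (∁ (preimage T)))
        (trans (lookup-map v not (preimage T)) (cong not (lookup∘tabulate (lookup T ∘ c) v))))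

    crossingWeight : Subset (suc (suc k)) → Fin n → Fin n → ℝ
    crossingWeight T u v =
      if does (u ∈? preimage T ×-dec v ∈? ∁ (preimage T)) then weight₀ D u v else 0ℝ

    ∑ofSize-arc : ∀ h t u v →
      ∑ofSize (suc (suc k)) (suc h) (λ T → seq (crossingWeight T u v) t) ≡
      fromℕ (k C h) ℚ.* seq (weight₀ D u v) t
    ∑ofSize-arc h t u v = trans
      (∑ofSize-cong (suc (suc k)) (suc h) λ T → trans (seq-if _ (weight₀ D u v) t)
        (cong (if_then seq (weight₀ D u v) t else 0ℚ) (crossing T u v)))
      count
      where
      count : ∑ofSize (suc (suc k)) (suc h)
                (λ T → if lookup T (c u) ∧ not (lookup T (c v)) then seq (weight₀ D u v) t else 0ℚ) ≡
              fromℕ (k C h) ℚ.* seq (weight₀ D u v) t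
      -- Properness gives the ends of an arc distinct colours, as the count requires; a non-arc
      -- contributes zero to both sides.
      count with arc? u v
      ... | yes u→v = ∑ofSize-∈-∉ k h (c u) (c v) _ (c-proper u v u→v)
      ... | no  _   = trans
        (∑ofSize-cong (suc (suc k)) (suc h) λ T → if-eta (lookup T (c u) ∧ not (lookup T (c v))))
        (trans (∑ofSize-0 (suc (suc k)) (suc h)) (sym (ℚ.*-zeroʳ (fromℕ (k C h)))))
        where
        if-eta : ∀ b → (if b then 0ℚ else 0ℚ) ≡ 0ℚ
        if-eta inside  = refl
        if-eta outside = refl

    -- Double counting: summed over the colour sets, the cuts contain each arc `k C h` times, and no
    -- cut exceeds `mac D`.
    average-cut : ∀ h t → fromℕ (k C h) ℚ.* seq (totalWeight D) t ℚ.≤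
                          fromℕ (suc (suc k) C suc h) ℚ.* seq (mac D) t
    average-cut h t = begin
      fromℕ (k C h) ℚ.* seq (totalWeight D) t
        ≡⟨ ∑ofSize-∑ (suc (suc k)) (suc h) t (fromℕ (k C h))
             (λ T u → ∑ (crossingWeight T u)) (λ u → ∑ (weight₀ D u))
             (λ u → ∑ofSize-∑ (suc (suc k)) (suc h) t (fromℕ (k C h))
                      (λ T → crossingWeight T u) (weight₀ D u) (∑ofSize-arc h t u)) ⟨
      ∑ofSize (suc (suc k)) (suc h) (λ T → seq (weightFromTo D (preimage T) (∁ (preimage T))) t)
        ≤⟨ ∑ofSize-mono-≤ (suc (suc k)) (suc h)
             (λ T → ≤-max (λ X → weightFromTo D X (∁ X)) (preimage T) t) ⟩
      ∑ofSize (suc (suc k)) (suc h) (λ _ → seq (mac D) t)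
        ≡⟨ ∑ofSize-const (suc (suc k)) (suc h) (seq (mac D) t) ⟩
      fromℕ (suc (suc k) C suc h) ℚ.* seq (mac D) t ∎
      where open ℚ.≤-Reasoning

-- The bound for odd and even path orders

-- An upper bound on `ν` is enough to colour with `2m + 2` colours, so one statement serves
-- `ν = 2m + 1` and `ν = 2m + 2`.
mac-bound : ∀ {n} (D : WeightedDigraph n) m {ν} →
  (∀ p → IsPath D p → length p ℕ.≤ ν) → ν ℕ.≤ suc (suc (m ℕ.* 2)) →
  ∀ a → fromℕ (4 ℕ.* suc (m ℕ.* 2)) ℚ.* a ≡ fromℕ (suc (suc (m ℕ.* 2))) →
  mac D ≥ a · totalWeight D
mac-bound {n} D m {ν} longest ν≤k a Aa≡B =
  let f , f<ν , proper = gallai-roy arc? (loopless refl) longest in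
  seq-≤⇒≤ (a · totalWeight D) (mac D) λ t →
    scale-≤ {fromℕ (4 ℕ.* suc l)} {fromℕ (suc (suc l))}
      {fromℕ (l C m)} {fromℕ (suc (suc l) C suc m)}
      {a} {seq (totalWeight D) t} {seq (mac D) t}
      (fromℕ-positive {4 ℕ.* suc l} ℕ.z<s)
      (fromℕ-positive {suc (suc l) C suc m} (nCk>0 (ℕ.s≤s m≤1+l)))
      -- Here `k = 2m` and `h = m`: the colour sets contain half of the colours.
      Aa≡B ratio (average-cut D (c f<ν) (c-proper f<ν proper) m t)
  where
  open WeightedDigraph D
  l = m ℕ.* 2
  m≤1+l : m ℕ.≤ suc l
  m≤1+l = ℕ.m≤n⇒m≤1+n (ℕ.m≤m*n m 2)
  ratio : fromℕ (l C m) ℚ.* fromℕ (4 ℕ.* suc l) ≡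
          fromℕ (suc (suc l)) ℚ.* fromℕ (suc (suc l) C suc m)
  ratio = trans (sym (fromℕ-homo-* (l C m) (4 ℕ.* suc l)))
    (trans (cong fromℕ (central-binomial m)) (fromℕ-homo-* (suc (suc l)) (suc (suc l) C suc m)))
  module _ {f : Fin n → ℕ} (f<ν : ∀ v → f v ℕ.< ν) where
    f<k : ∀ v → f v ℕ.< suc (suc l)
    f<k v = ℕ.<-≤-trans (f<ν v) ν≤k
    c : Fin n → Fin (suc (suc l))
    c v = fromℕ< (f<k v)
    c-proper : Proper arc? f → ∀ u v → Arc u v → c u ≢ c v
    c-proper proper u v u→v cu≡cv =
      proper u v u→v (Fin.fromℕ<-injective (f u) (f v) (f<k u) (f<k v) cu≡cv)

-- A single vertex is already a path, so there are no vertices and both weights are zero.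
mac≥·totalWeight-empty : ∀ {n} (D : WeightedDigraph n) → (∀ p → IsPath D p → length p ℕ.≤ 0) →
  ∀ a → mac D ≥ a · totalWeight D
mac≥·totalWeight-empty {zero}  D _       a =
  seq-≤⇒≤ (a · totalWeight D) (mac D) λ t → ℚ.≤-reflexive (ℚ.*-zeroʳ a)
mac≥·totalWeight-empty {suc n} D longest a =
  contradiction (longest (zero ∷ []) ([-] , [] ∷ [])) λ ()

odd⇒≡1+[n/2]*2 : ∀ ν → 2 ∤ ν → ν ≡ suc (ν ℕ./ 2 ℕ.* 2)
odd⇒≡1+[n/2]*2 ν 2∤ν with ν % 2 in eq | m%n<n ν 2 | m≡m%n+[m/n]*n ν 2
... | 0 | _ | _ = contradiction (m%n≡0⇒n∣m ν 2 eq) 2∤ν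
... | 1 | _ | e = e
... | suc (suc _) | ℕ.s≤s (ℕ.s≤s ()) | _

mainTheorem3 : ∀ {n : ℕ} (D : WeightedDigraph n) (ν : ℕ) →
    IsLongestPathOrder D ν →
    ((odd : 2 ∤ ν) →
    mac D ≥ (+ 1 / 4 ℚ.+ 1/4[ + ν ] (odd⇒ν≢0 odd)) · totalWeight D) ×
    ((even : 2 ∣ ν) →
    mac D ≥ (+ 1 / 4 ℚ.+ 1/4[ + ν ℤ.- + 1 ] (even⇒ν-1≢0 even)) · totalWeight D)
mainTheorem3 D ν (_ , longest) = odd-case , even-case
  where
  odd-case : (odd : 2 ∤ ν) → mac D ≥ (+ 1 / 4 ℚ.+ 1/4[ + ν ] (odd⇒ν≢0 odd)) · totalWeight D
  -- For `m = ν / 2` we have `ν = 2m + 1`; one spare colour makes the number of colours even.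
  odd-case odd = mac-bound D (ν ℕ./ 2) longest
    (ℕ.≤-trans (ℕ.≤-reflexive (odd⇒≡1+[n/2]*2 ν odd)) (ℕ.n≤1+n _))
    (+ 1 / 4 ℚ.+ 1/4[ + ν ] (odd⇒ν≢0 odd))
    (coefficient (ν ℕ./ 2 ℕ.* 2) (cong +_ (odd⇒≡1+[n/2]*2 ν odd)) (odd⇒ν≢0 odd))
  even-case : (even : 2 ∣ ν) →
    mac D ≥ (+ 1 / 4 ℚ.+ 1/4[ + ν ℤ.- + 1 ] (even⇒ν-1≢0 even)) · totalWeight D
  -- The coefficient contains `even`, so it is generalised to `a` before `even` is split.
  even-case even = from even (+ 1 / 4 ℚ.+ 1/4[ + ν ℤ.- + 1 ] (even⇒ν-1≢0 even))
    λ m ν≡ → coefficient (m ℕ.* 2) (cong (λ a → + a ℤ.- + 1) ν≡) (even⇒ν-1≢0 even)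
    where
    from : 2 ∣ ν → ∀ a →
      (∀ m → ν ≡ suc m ℕ.* 2 → fromℕ (4 ℕ.* suc (m ℕ.* 2)) ℚ.* a ≡ fromℕ (suc (suc (m ℕ.* 2)))) →
      mac D ≥ a · totalWeight D
    from (divides zero    ν≡) a _    =
      mac≥·totalWeight-empty D (λ p path → subst (length p ℕ.≤_) ν≡ (longest p path)) a
    -- Here `ν = 2m + 2` is exactly the number of colours, and `ν - 1 = 2m + 1` is the denominator's
    -- factor.
    from (divides (suc m) ν≡) a spec = mac-bound D m longest (ℕ.≤-reflexive ν≡) a (spec m ν≡)
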